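{- In black-peg, non-adaptive Mastermind with no repeats, $\Omega(n\log k)$ guesses are required to identify the hidden sequence $H$. That is, there is an absolute constant $c>0$ such that for all integers $1\le n\le k$ and every finite collection of queries $Q_1,\dots,Q_s$ (sequences of length $n$ with pairwise distinct entries in $[k]=\{1,\dots,k\}$) which identifies every hidden sequence, one has $s\ge c\, n\log k$.
   Context: Let $\mathcal{V}$ be the set of sequences in $[k]^n$ with pairwise distinct entries. In black-peg, non-adaptive Mastermind with no repeats, the hidden sequence $H$ is an element of $\mathcal{V}$, and the codebreaker submits all queries $Q_1,\dots,Q_s\in\mathcal{V}$ at once. The codebreaker then receives all the responses $b(Q_1,H),\dots,b(Q_s,H)$, where $b(Q,H)=|\{i\in\{1,\dots,n\}: q_i=h_i\}|$, and must determine $H$ from them with no additional guesses. The collection $Q_1,\dots,Q_s$ identifies every hidden sequence if, for all $H,H'\in\mathcal{V}$, $b(Q_i,H)=b(Q_i,H')$ for all $1\le i\le s$ implies $H=H'$. -}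

module Defs where

open import Data.Nat.Base as ℕ using (ℕ; suc)
open import Data.Integer.Base using (+_; -[1+_])
open import Data.Rational.Base using (ℚ; mkℚ; _/_; _*_; _≤_)
open import Data.Fin.Base using (Fin)
open import Data.Fin.Properties using (_≟_)
open import Data.Vec.Base using (Vec; lookup; count; allFin)
open import Data.Vec.Relation.Unary.Unique.Propositional using (Unique)
open import Data.Unit.Base using (⊤)
open import Relation.Binary.PropositionalEquality.Core using (_≡_)

record Code (n k : ℕ) : Set where
  constructor code
  field
    entries  : Vec (Fin k) n
    distinct : Unique entries

open Code public

blackPegs : ∀ {n k} → Code n k → Code n k → ℕ
blackPegs {n} Q H =
  count (λ i → lookup (entries Q) i ≟ lookup (entries H) i) (allFin n)

-- Codes are compared by their entries; the distinctness proof is not data.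
Identifies : ∀ {n k s} → (Fin s → Code n k) → Set
Identifies {n} {k} Q =
  ∀ (H H′ : Code n k) →
  (∀ i → blackPegs (Q i) H ≡ blackPegs (Q i) H′) →
  entries H ≡ entries H′

fromℕ : ℕ → ℚ
fromℕ m = + m / 1

-- The lower Dedekind cut of the real number log₂ k, for k ≥ 1 (where
-- log₂ k ≥ 0):  a/b ≤ log₂ k  iff  2ᵃ ≤ kᵇ.  The second component of mkℚ is
-- the denominator minus one.
_≤log₂_ : ℚ → ℕ → Set
mkℚ (+ a)    b-1 _ ≤log₂ k = 2 ℕ.^ a ℕ.≤ k ℕ.^ suc b-1
mkℚ -[1+ _ ] _   _ ≤log₂ k = ⊤

-- The inequality of real numbers  x · log₂ k ≤ y,  for x ≥ 0 and k ≥ 1: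
-- x · log₂ k is the supremum of the x · r over the rationals r ≤ log₂ k.
infix 4 _·log₂_≤_
_·log₂_≤_ : ℚ → ℕ → ℚ → Set
x ·log₂ k ≤ y = ∀ r → r ≤log₂ k → x * r ≤ y

{-# OPTIONS --safe #-}

-- For fixed codes Q and H, the k translates H + t (mod k) satisfy Σₜ b(Q, H + t) ≤ n,
-- because at each position at most one translate agrees with Q.  Averaging over t,
-- every H has a translate whose s responses have sum at most s.  There are at most
-- 4ˢ response vectors of sum at most s, and the codes starting with 0 have pairwise
-- disjoint translation orbits, so (k-1)(k-2)⋯(k-n+1) ≤ 4ˢ.  The square of the left
-- side is at least (k-1)ⁿ⁻¹, which yields kⁿ ≤ 2¹⁶ˢ when n ≥ 3.  For n ≤ 2 it is
-- enough to compare the k translates of a single code, whose responses are at most n.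
module Submission where

open import Defs
open import Data.Nat.Base using (ℕ; _≤_)
open import Data.Fin.Base using (Fin)
open import Data.Product.Base using (∃-syntax; _×_)
open import Data.Rational.Base using (ℚ; 0ℚ; _<_; _*_)

open import Data.Bool.Base using (if_then_else_; true; false)
open import Data.Fin.Base using (zero; suc; toℕ; fromℕ<; remQuot; combine; punchIn)
open import Data.Fin.Properties using (_≟_; any?; injective⇒≤; toℕ-injective; toℕ<n; toℕ-fromℕ<; fromℕ<-injective; combine-remQuot; punchIn-injective; punchInᵢ≢i; suc-injective)
import Data.Integer.Base as ℤ
import Data.Integer.Properties as ℤ
open import Data.Nat.Base as ℕ using (zero; suc; z≤n; s≤s; NonZero; _+_; _∸_; _^_; _%_)
open import Data.Nat.DivMod using (_mod_; m%n<n; [m+n]%n≡m%n; m<n⇒m%n≡m; %-distribˡ-+)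
import Data.Nat.Properties as ℕ
open import Data.Nat.Tactic.RingSolver using (solve-∀)
open import Data.Product.Base using (_,_; proj₁; proj₂; uncurry)
open import Data.Rational.Base using (mkℚ; _/_; toℚᵘ; NonNegative)
import Data.Rational.Base as ℚ
import Data.Rational.Properties as ℚ
open import Data.Rational.Unnormalised.Base using (mkℚᵘ; *≤*)
import Data.Rational.Unnormalised.Base as ℚᵘ
import Data.Rational.Unnormalised.Properties as ℚᵘ
open import Data.Vec.Base using (Vec; []; _∷_; map; lookup; count; tabulate; allFin)
open import Data.Vec.Properties using (lookup-map; count≤n; ∷-injective)
import Data.Vec.Relation.Unary.All as All
import Data.Vec.Relation.Unary.All.Properties as All
open import Data.Vec.Relation.Unary.AllPairs using ([]; _∷_)
open import Data.Vec.Relation.Unary.Unique.Propositional using (Unique)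
open import Data.Vec.Relation.Unary.Unique.Propositional.Properties using (map⁺)
open import Function.Base using (_∘_; id)
open import Relation.Binary.PropositionalEquality
open import Relation.Nullary using (Dec; yes; no; does; contradiction; ¬_)

open import Algebra.Properties.CommutativeMonoid.Sum ℕ.+-0-commutativeMonoid using (sum; ∑-comm; sum-cong-≗)

-- Vectors, finite sums and counting.

map-injective : ∀ {a b n} {A : Set a} {B : Set b} {f : A → B} → (∀ {x y} → f x ≡ f y → x ≡ y) →
                {xs ys : Vec A n} → map f xs ≡ map f ys → xs ≡ ys
map-injective f-injective {[]}     {[]}     _  = refl
map-injective f-injective {x ∷ xs} {y ∷ ys} eq =
  cong₂ _∷_ (f-injective (proj₁ (∷-injective eq))) (map-injective f-injective (proj₂ (∷-injective eq)))

sum-≤-* : ∀ {m c} (f : Fin m → ℕ) → (∀ i → f i ≤ c) → sum f ≤ m ℕ.* c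
sum-≤-* {zero}  f f≤c = z≤n
sum-≤-* {suc m} f f≤c = ℕ.+-mono-≤ (f≤c zero) (sum-≤-* (f ∘ suc) (f≤c ∘ suc))

*-≤-sum : ∀ {m c} (f : Fin m → ℕ) → (∀ i → c ≤ f i) → m ℕ.* c ≤ sum f
*-≤-sum {zero}  f c≤f = z≤n
*-≤-sum {suc m} f c≤f = ℕ.+-mono-≤ (c≤f zero) (*-≤-sum (f ∘ suc) (c≤f ∘ suc))

sum<*⇒∃< : ∀ {m c} (f : Fin m → ℕ) → sum f ℕ.< m ℕ.* c → ∃[ i ] f i ℕ.< c
sum<*⇒∃< {m} {c} f Σf<mc with any? (λ i → f i ℕ.<? c)
... | yes found = found
... | no ¬found = contradiction (*-≤-sum f (λ i → ℕ.≮⇒≥ (λ fi<c → ¬found (i , fi<c)))) (ℕ.<⇒≱ Σf<mc)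

indicator : ∀ {p} {P : Set p} → Dec P → ℕ
indicator P? = if does P? then 1 else 0

indicator-no : ∀ {p} {P : Set p} (P? : Dec P) → ¬ P → indicator P? ≤ 0
indicator-no (yes p) ¬p = contradiction p ¬p
indicator-no (no _)  _  = z≤n

count-tabulate : ∀ {a p} {A : Set a} {P : A → Set p} (P? : ∀ x → Dec (P x)) {m} (g : Fin m → A) →
                 count P? (tabulate g) ≡ sum (λ i → indicator (P? (g i)))
count-tabulate P? {zero}  g = refl
count-tabulate P? {suc m} g with does (P? (g zero))
... | true  = cong suc (count-tabulate P? (g ∘ suc))
... | false = count-tabulate P? (g ∘ suc)

sum-indicator-≤1 : ∀ {m p} {P : Fin m → Set p} (P? : ∀ i → Dec (P i)) →
                   (∀ {i j} → P i → P j → i ≡ j) → sum (λ i → indicator (P? i)) ≤ 1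
sum-indicator-≤1 {zero}  P? unique = z≤n
sum-indicator-≤1 {suc m} P? unique with P? zero
... | no _   = sum-indicator-≤1 (P? ∘ suc) (λ p q → suc-injective (unique p q))
... | yes p₀ = s≤s (subst (sum (λ i → indicator (P? (suc i))) ≤_) (ℕ.*-zeroʳ m)
                 (sum-≤-* _ (λ i → indicator-no (P? (suc i)) (λ p → 0≢suc (unique p₀ p)))))
  where
  0≢suc : ∀ {i : Fin m} → zero ≢ suc i
  0≢suc ()

-- Encoding response vectors by natural numbers.

-- Iterates (b , y) ↦ 2ᵇ (2y + 1), so that only Σ b + s bits are needed.
encode : ∀ {s} → (Fin s → ℕ) → ℕ
encode {zero}  b = 0
encode {suc s} b = 2 ^ b zero ℕ.* suc (2 ℕ.* encode (b ∘ suc))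

encode-< : ∀ {s} (b : Fin s → ℕ) → encode b ℕ.< 2 ^ (sum b + s)
encode-< {zero}  b = s≤s z≤n
encode-< {suc s} b = begin-strict
  2 ^ b zero ℕ.* suc (2 ℕ.* e)                     <⟨ ℕ.*-monoʳ-< (2 ^ b zero) {{ℕ.m^n≢0 2 (b zero)}} (ℕ.≤-reflexive (2+2*e e)) ⟩
  2 ^ b zero ℕ.* (2 ℕ.* suc e)                     ≤⟨ ℕ.*-monoʳ-≤ (2 ^ b zero) (ℕ.*-monoʳ-≤ 2 (encode-< (b ∘ suc))) ⟩
  2 ^ b zero ℕ.* 2 ^ suc (sum (b ∘ suc) + s)       ≡⟨ ℕ.^-distribˡ-+-* 2 (b zero) _ ⟨
  2 ^ (b zero + suc (sum (b ∘ suc) + s))           ≡⟨ cong (2 ^_) (regroup (b zero) (sum (b ∘ suc)) s) ⟩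
  2 ^ (sum b + suc s)                              ∎
  where
  open ℕ.≤-Reasoning
  e = encode (b ∘ suc)
  2+2*e : ∀ e → suc (suc (2 ℕ.* e)) ≡ 2 ℕ.* suc e
  2+2*e = solve-∀
  regroup : ∀ x y s → x + suc (y + s) ≡ (x + y) + suc s
  regroup = solve-∀

-- Uniqueness of the 2-adic valuation and the odd part: halving both sides lowers both exponents,
-- and parity excludes the case where only one of them is zero.
2^*odd-injective : ∀ m n x y → 2 ^ m ℕ.* suc (2 ℕ.* x) ≡ 2 ^ n ℕ.* suc (2 ℕ.* y) → m ≡ n × x ≡ y
2^*odd-injective zero zero x y eq =
  refl , ℕ.*-cancelˡ-≡ x y 2 (ℕ.suc-injective (trans (sym (ℕ.*-identityˡ _)) (trans eq (ℕ.*-identityˡ _))))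
2^*odd-injective zero (suc n) x y eq =
  contradiction (trans (sym (ℕ.*-assoc 2 (2 ^ n) _)) (trans (sym eq) (ℕ.*-identityˡ _))) (ℕ.even≢odd (2 ^ n ℕ.* suc (2 ℕ.* y)) x)
2^*odd-injective (suc m) zero x y eq =
  contradiction (trans (sym (ℕ.*-assoc 2 (2 ^ m) _)) (trans eq (ℕ.*-identityˡ _))) (ℕ.even≢odd (2 ^ m ℕ.* suc (2 ℕ.* x)) y)
2^*odd-injective (suc m) (suc n) x y eq
  with 2^*odd-injective m n x y
         (ℕ.*-cancelˡ-≡ _ _ 2 (trans (sym (ℕ.*-assoc 2 (2 ^ m) _)) (trans eq (ℕ.*-assoc 2 (2 ^ n) _))))
... | m≡n , x≡y = cong suc m≡n , x≡y

encode-injective : ∀ {s} (b b′ : Fin s → ℕ) → encode b ≡ encode b′ → ∀ i → b i ≡ b′ i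
encode-injective {suc s} b b′ eq with 2^*odd-injective (b zero) (b′ zero) _ _ eq
... | b₀≡ , eq′ = λ { zero → b₀≡ ; (suc i) → encode-injective (b ∘ suc) (b′ ∘ suc) eq′ i }

-- Responses to an identifying collection.

totalPegs : ∀ {n k s} → (Fin s → Code n k) → Code n k → ℕ
totalPegs Q H = sum (λ i → blackPegs (Q i) H)

totalPegs-≤ : ∀ {n k s} (Q : Fin s → Code n k) H → totalPegs Q H ≤ s ℕ.* n
totalPegs-≤ {n} Q H =
  sum-≤-* _ (λ i → count≤n (λ j → lookup (entries (Q i)) j ≟ lookup (entries H) j) (allFin n))

-- The responses determine the code, hence the index `x`, and their encoding lies below
-- `2 ^ (B + s)`. This injects `Fin N` into `Fin (2 ^ (B + s))`.
identified-family-bound :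
  ∀ {n k s N} (Q : Fin s → Code n k) → Identifies Q →
  (f : Fin N → Code n k) → (∀ {x y} → entries (f x) ≡ entries (f y) → x ≡ y) →
  ∀ B → (∀ x → totalPegs Q (f x) ≤ B) → N ≤ 2 ^ (B + s)
identified-family-bound {s = s} {N} Q identifies f f-injective B total≤B =
  injective⇒≤ {f = λ x → fromℕ< (code< x)} λ {x} {y} eq →
    f-injective (identifies (f x) (f y)
      (encode-injective (responses x) (responses y) (fromℕ<-injective _ _ (code< x) (code< y) eq)))
  where
  responses : Fin N → Fin s → ℕ
  responses x i = blackPegs (Q i) (f x)
  code< : ∀ x → encode (responses x) ℕ.< 2 ^ (B + s)
  code< x = ℕ.<-≤-trans (encode-< (responses x)) (ℕ.^-monoʳ-≤ 2 (ℕ.+-monoˡ-≤ s (total≤B x)))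

-- Cyclic translation of codes.

module _ {k : ℕ} .{{_ : NonZero k}} where

  infixl 6 _⊕_
  _⊕_ : Fin k → Fin k → Fin k
  t ⊕ a = (toℕ t + toℕ a) mod k

  ⊕-comm : ∀ t a → t ⊕ a ≡ a ⊕ t
  ⊕-comm t a = cong (_mod k) (ℕ.+-comm (toℕ t) (toℕ a))

  -- Here `(k ∸ toℕ t) % k` is the additive inverse of `t` modulo `k`; reducing it first puts the
  -- sum in the shape of `%-distribˡ-+`.
  ⊕-undo : ∀ t a → ((k ∸ toℕ t) % k + toℕ (t ⊕ a)) % k ≡ toℕ a
  ⊕-undo t a = begin
    ((k ∸ toℕ t) % k + toℕ (t ⊕ a)) % k            ≡⟨ cong (λ z → ((k ∸ toℕ t) % k + z) % k) (toℕ-fromℕ< (m%n<n (toℕ t + toℕ a) k)) ⟩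
    ((k ∸ toℕ t) % k + (toℕ t + toℕ a) % k) % k    ≡⟨ %-distribˡ-+ (k ∸ toℕ t) (toℕ t + toℕ a) k ⟨
    ((k ∸ toℕ t) + (toℕ t + toℕ a)) % k            ≡⟨ cong (_% k) (ℕ.+-assoc (k ∸ toℕ t) (toℕ t) (toℕ a)) ⟨
    ((k ∸ toℕ t) + toℕ t + toℕ a) % k              ≡⟨ cong (λ z → (z + toℕ a) % k) (ℕ.m∸n+n≡m (ℕ.<⇒≤ (toℕ<n t))) ⟩
    (k + toℕ a) % k                                ≡⟨ cong (_% k) (ℕ.+-comm k (toℕ a)) ⟩
    (toℕ a + k) % k                                ≡⟨ [m+n]%n≡m%n (toℕ a) k ⟩
    toℕ a % k                                      ≡⟨ m<n⇒m%n≡m (toℕ<n a) ⟩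
    toℕ a                                          ∎
    where open ≡-Reasoning

  ⊕-cancelˡ : ∀ t {a b} → t ⊕ a ≡ t ⊕ b → a ≡ b
  ⊕-cancelˡ t {a} {b} eq = toℕ-injective (begin
    toℕ a                                  ≡⟨ ⊕-undo t a ⟨
    ((k ∸ toℕ t) % k + toℕ (t ⊕ a)) % k    ≡⟨ cong (λ z → ((k ∸ toℕ t) % k + toℕ z) % k) eq ⟩
    ((k ∸ toℕ t) % k + toℕ (t ⊕ b)) % k    ≡⟨ ⊕-undo t b ⟩
    toℕ b                                  ∎)
    where open ≡-Reasoning

  ⊕-cancelʳ : ∀ a {t u} → t ⊕ a ≡ u ⊕ a → t ≡ u
  ⊕-cancelʳ a {t} {u} eq = ⊕-cancelˡ a (trans (⊕-comm a t) (trans eq (⊕-comm u a)))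

  translate : ∀ {n} → Fin k → Code n k → Code n k
  translate t H = code (map (t ⊕_) (entries H)) (map⁺ (⊕-cancelˡ t) (distinct H))

  -- Double counting: after exchanging the sums, each position contributes at most 1, since the
  -- shift taking the entry of `H` there to that of `Q` is unique.
  sum-blackPegs-translate : ∀ {n} (Q H : Code n k) → sum (λ t → blackPegs Q (translate t H)) ≤ n
  sum-blackPegs-translate {n} Q H = begin
    sum (λ t → blackPegs Q (translate t H))              ≡⟨ sum-cong-≗ (λ t → count-tabulate (agree? t) id) ⟩
    sum (λ t → sum (λ j → indicator (agree? t j)))       ≡⟨ ∑-comm (λ t j → indicator (agree? t j)) ⟩
    sum (λ j → sum (λ t → indicator (agree? t j)))       ≤⟨ sum-≤-* _ (λ j → sum-indicator-≤1 (λ t → agree? t j) (agree-unique j)) ⟩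
    n ℕ.* 1                                              ≡⟨ ℕ.*-identityʳ n ⟩
    n                                                    ∎
    where
    open ℕ.≤-Reasoning
    agree? : ∀ t j → Dec (lookup (entries Q) j ≡ lookup (map (t ⊕_) (entries H)) j)
    agree? t j = lookup (entries Q) j ≟ lookup (map (t ⊕_) (entries H)) j
    agree-unique : ∀ j {t u} → lookup (entries Q) j ≡ lookup (map (t ⊕_) (entries H)) j →
                   lookup (entries Q) j ≡ lookup (map (u ⊕_) (entries H)) j → t ≡ u
    agree-unique j {t} {u} eq eq′ = ⊕-cancelʳ (lookup (entries H) j)
      (trans (sym (lookup-map j (t ⊕_) (entries H))) (trans (sym eq) (trans eq′ (lookup-map j (u ⊕_) (entries H)))))

  ∃-translate-totalPegs-≤ : ∀ {n s} → n ≤ k → (Q : Fin s → Code n k) (H : Code n k) →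
                            ∃[ t ] totalPegs Q (translate t H) ≤ s
  ∃-translate-totalPegs-≤ {n} {s} n≤k Q H =
    let (t , total<1+s) = sum<*⇒∃< (λ t → totalPegs Q (translate t H)) average in t , ℕ.≤-pred total<1+s
    where
    open ℕ.≤-Reasoning
    -- Comparing with `suc s` makes the inequality strict, as the pigeonhole step requires; the
    -- translate it finds has total below `suc s`, that is, at most `s`.
    average : sum (λ t → totalPegs Q (translate t H)) ℕ.< k ℕ.* suc s
    average = begin-strict
      sum (λ t → totalPegs Q (translate t H))                    ≡⟨ ∑-comm (λ t i → blackPegs (Q i) (translate t H)) ⟩
      sum (λ i → sum (λ t → blackPegs (Q i) (translate t H)))    ≤⟨ sum-≤-* _ (λ i → sum-blackPegs-translate (Q i) H) ⟩
      s ℕ.* n                                                    ≤⟨ ℕ.*-monoʳ-≤ s n≤k ⟩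
      s ℕ.* k                                                    ≡⟨ ℕ.*-comm s k ⟩
      k ℕ.* s                                                    <⟨ ℕ.*-monoʳ-< k (ℕ.n<1+n s) ⟩
      k ℕ.* suc s                                                ∎

-- Falling factorials and enumeration of codes.

falling : ℕ → ℕ → ℕ
falling k       zero    = 1
falling zero    (suc n) = 0
falling (suc k) (suc n) = suc k ℕ.* falling k n

-- The index is read in mixed radix: one digit is the head `h`, the remainder indexes an arrangement
-- of the other symbols, which `punchIn h` relabels so as to avoid `h`.
arrangement : ∀ k n → Fin (falling k n) → Vec (Fin k) n
arrangement k       zero    _ = []
arrangement (suc k) (suc n) x =
  let (h , y) = remQuot (falling k n) x in h ∷ map (punchIn h) (arrangement k n y)

arrangement-unique : ∀ k n x → Unique (arrangement k n x)
arrangement-unique k       zero    x = []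
arrangement-unique (suc k) (suc n) x =
  All.map⁺ (All.universal (λ a eq → punchInᵢ≢i h a (sym eq)) _)
    ∷ map⁺ (λ {a} {b} → punchIn-injective h a b) (arrangement-unique k n y)
  where
  h = proj₁ (remQuot {suc k} (falling k n) x)
  y = proj₂ (remQuot {suc k} (falling k n) x)

arrangement-injective : ∀ k n {x y} → arrangement k n x ≡ arrangement k n y → x ≡ y
arrangement-injective k       zero    {zero} {zero} _ = refl
arrangement-injective (suc k) (suc n) {x} {y} eq with ∷-injective eq
... | h≡ , tail≡ = begin
  x                                                    ≡⟨ combine-remQuot {suc k} (falling k n) x ⟨
  uncurry combine (remQuot {suc k} (falling k n) x)    ≡⟨ cong (uncurry combine) (cong₂ _,_ h≡ rest≡) ⟩
  uncurry combine (remQuot {suc k} (falling k n) y)    ≡⟨ combine-remQuot {suc k} (falling k n) y ⟩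
  y                                                    ∎
  where
  open ≡-Reasoning
  hy = proj₁ (remQuot {suc k} (falling k n) y)
  -- Since the heads agree, both tails are relabelled around the same value `hy`, and the injective
  -- map `punchIn hy` cancels.
  rest≡ = arrangement-injective k n
    (map-injective (λ {a} {b} → punchIn-injective hy a b)
      (trans (cong (λ h → map (punchIn h) (arrangement k n (proj₂ (remQuot {suc k} (falling k n) x)))) (sym h≡)) tail≡))

-- The codes with first entry 0 represent the orbits of translation.
normalCode : ∀ k n → Fin (falling k n) → Code (suc n) (suc k)
normalCode k n x = code (zero ∷ map suc (arrangement k n x))
  (All.map⁺ (All.universal (λ _ ()) _) ∷ map⁺ suc-injective (arrangement-unique k n x))

-- The first entry of the translate is the shift applied to 0, so it reveals the shift; undoing the
-- shift then recovers the arrangement.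
translate-normalCode-injective : ∀ k n t u x y →
  entries (translate t (normalCode k n x)) ≡ entries (translate u (normalCode k n y)) → t ≡ u × x ≡ y
translate-normalCode-injective k n t u x y eq
  with ⊕-cancelʳ zero {t} {u} (proj₁ (∷-injective eq))
... | refl = refl , arrangement-injective k n
  (map-injective suc-injective (map-injective (⊕-cancelˡ t) (proj₂ (∷-injective eq))))

-- Counting bounds for identifying collections.

falling-bound : ∀ {k n s} → n ≤ k → (Q : Fin s → Code (suc n) (suc k)) → Identifies Q →
                falling k n ≤ 2 ^ (s + s)
falling-bound {k} {n} {s} n≤k Q identifies =
  identified-family-bound Q identifies
    -- The shift may depend on `x`: orbits of different normal codes are disjoint, so choosing a
    -- light representative in each keeps the family injective.
    (λ x → translate (proj₁ (light x)) (normalCode k n x))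
    (λ {x} {y} eq → proj₂ (translate-normalCode-injective k n (proj₁ (light x)) (proj₁ (light y)) x y eq))
    s (λ x → proj₂ (light x))
  where
  light : ∀ x → ∃[ t ] totalPegs Q (translate t (normalCode k n x)) ≤ s
  light x = ∃-translate-totalPegs-≤ (s≤s n≤k) Q (normalCode k n x)

falling>0 : ∀ {k n} → n ≤ k → 0 ℕ.< falling k n
falling>0 z≤n             = s≤s z≤n
falling>0 (s≤s {n} {k} n≤k) = ℕ.*-mono-≤ {1} {suc k} (s≤s z≤n) (falling>0 n≤k)

-- A single orbit already has `suc k` members, and the crude bound of `suc n` pegs per query
-- suffices for codes of length 1 and 2.
alphabet-bound : ∀ {k n s} → n ≤ k → (Q : Fin s → Code (suc n) (suc k)) → Identifies Q →
                 suc k ≤ 2 ^ (s ℕ.* suc n + s)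
alphabet-bound {k} {n} {s} n≤k Q identifies =
  identified-family-bound Q identifies
    (λ t → translate t (normalCode k n x₀))
    (λ {t} {u} eq → proj₁ (translate-normalCode-injective k n t u x₀ x₀ eq))
    (s ℕ.* suc n) (λ t → totalPegs-≤ Q (translate t (normalCode k n x₀)))
  where
  x₀ = fromℕ< (falling>0 n≤k)

-- From falling factorials to powers.

suc^≤^*suc : ∀ k j → j ≤ k → suc k ^ j ≤ k ^ j ℕ.* suc j
suc^≤^*suc k zero    _   = s≤s z≤n
suc^≤^*suc k (suc j) j<k = begin
  suc k ℕ.* suc k ^ j               ≤⟨ ℕ.*-monoʳ-≤ (suc k) (suc^≤^*suc k j (ℕ.<⇒≤ j<k)) ⟩
  suc k ℕ.* (k ^ j ℕ.* suc j)       ≡⟨ expand k (k ^ j) j ⟩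
  -- The hypothesis `suc j ≤ k` turns `suc k * suc j` into at most `k * suc (suc j)`.
  k ^ j ℕ.* (k ℕ.* suc j + suc j)   ≤⟨ ℕ.*-monoʳ-≤ (k ^ j) (ℕ.+-monoʳ-≤ (k ℕ.* suc j) j<k) ⟩
  k ^ j ℕ.* (k ℕ.* suc j + k)       ≡⟨ collect k (k ^ j) j ⟩
  k ℕ.* k ^ j ℕ.* suc (suc j)       ∎
  where
  open ℕ.≤-Reasoning
  expand : ∀ k p j → suc k ℕ.* (p ℕ.* suc j) ≡ p ℕ.* (k ℕ.* suc j + suc j)
  expand = solve-∀
  collect : ∀ k p j → p ℕ.* (k ℕ.* suc j + k) ≡ k ℕ.* p ℕ.* suc (suc j)
  collect = solve-∀

-- Raising both `k` and `n` by one multiplies the right side by `suc k` squared, and the left side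
-- by at most `suc k * suc n`, by `suc^≤^*suc`.
^≤falling² : ∀ {k n} → n ≤ k → k ^ n ≤ falling k n ℕ.* falling k n
^≤falling² z≤n = s≤s z≤n
^≤falling² (s≤s {n} {k} n≤k) = begin
  suc k ℕ.* suc k ^ n                      ≤⟨ ℕ.*-monoʳ-≤ (suc k) (suc^≤^*suc k n n≤k) ⟩
  suc k ℕ.* (k ^ n ℕ.* suc n)              ≤⟨ ℕ.*-monoʳ-≤ (suc k) (ℕ.*-mono-≤ (^≤falling² n≤k) (s≤s n≤k)) ⟩
  suc k ℕ.* (falling k n ℕ.* falling k n ℕ.* suc k)   ≡⟨ regroup (suc k) (falling k n) ⟩
  suc k ℕ.* falling k n ℕ.* (suc k ℕ.* falling k n)   ∎
  where
  open ℕ.≤-Reasoning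
  regroup : ∀ a f → a ℕ.* (f ℕ.* f ℕ.* a) ≡ a ℕ.* f ℕ.* (a ℕ.* f)
  regroup = solve-∀

^-bound-short : ∀ k n s e → k ≤ 2 ^ e → e ℕ.* n ≤ 16 ℕ.* s → k ^ n ≤ 2 ^ (16 ℕ.* s)
^-bound-short k n s e k≤2^e en≤16s = begin
  k ^ n              ≤⟨ ℕ.^-monoˡ-≤ n k≤2^e ⟩
  (2 ^ e) ^ n        ≡⟨ ℕ.^-*-assoc 2 e n ⟩
  2 ^ (e ℕ.* n)      ≤⟨ ℕ.^-monoʳ-≤ 2 en≤16s ⟩
  2 ^ (16 ℕ.* s)     ∎
  where open ℕ.≤-Reasoning

-- Here `n` counts the entries after the first. The left side is at most `k ^ (4 * n)`, hence at
-- most the eighth power of `falling k n`; with `falling k n ≤ 2 ^ (2 * s)` this produces the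
-- constant 16.
^-bound-long : ∀ k n s → 2 ≤ n → n ≤ k → falling k n ≤ 2 ^ (s + s) → suc k ^ suc n ≤ 2 ^ (16 ℕ.* s)
^-bound-long k n s 2≤n n≤k falling≤ = begin
  suc k ^ suc n                          ≤⟨ ℕ.^-monoˡ-≤ (suc n) 1+k≤k² ⟩
  (k ^ 2) ^ suc n                        ≡⟨ ℕ.^-*-assoc k 2 (suc n) ⟩
  k ^ (2 ℕ.* suc n)                      ≤⟨ ℕ.^-monoʳ-≤ k {{ℕ.>-nonZero (ℕ.≤-trans (s≤s z≤n) 2≤k)}} 2+2n≤4n ⟩
  k ^ (n ℕ.* 4)                          ≡⟨ ℕ.^-*-assoc k n 4 ⟨
  (k ^ n) ^ 4                            ≤⟨ ℕ.^-monoˡ-≤ 4 (ℕ.≤-trans (^≤falling² n≤k) (ℕ.*-mono-≤ falling≤ falling≤)) ⟩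
  (2 ^ (s + s) ℕ.* 2 ^ (s + s)) ^ 4      ≡⟨ cong (_^ 4) (ℕ.^-distribˡ-+-* 2 (s + s) (s + s)) ⟨
  (2 ^ (s + s + (s + s))) ^ 4            ≡⟨ ℕ.^-*-assoc 2 (s + s + (s + s)) 4 ⟩
  2 ^ ((s + s + (s + s)) ℕ.* 4)          ≡⟨ cong (2 ^_) (16s s) ⟩
  2 ^ (16 ℕ.* s)                         ∎
  where
  open ℕ.≤-Reasoning
  2≤k = ℕ.≤-trans 2≤n n≤k
  16s : ∀ s → (s + s + (s + s)) ℕ.* 4 ≡ 16 ℕ.* s
  16s = solve-∀
  1+k≤k² : suc k ≤ k ^ 2
  1+k≤k² = begin
    1 + k              ≤⟨ ℕ.+-monoˡ-≤ k (ℕ.≤-trans (s≤s z≤n) 2≤k) ⟩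
    k + k              ≡⟨ cong (k +_) (ℕ.+-identityʳ k) ⟨
    2 ℕ.* k            ≤⟨ ℕ.*-monoˡ-≤ k 2≤k ⟩
    k ℕ.* k            ≡⟨ cong (k ℕ.*_) (ℕ.*-identityʳ k) ⟨
    k ^ 2              ∎
  2+2n≤4n : 2 ℕ.* suc n ≤ n ℕ.* 4
  2+2n≤4n = begin
    2 ℕ.* suc n        ≡⟨ ℕ.*-suc 2 n ⟩
    2 + 2 ℕ.* n        ≤⟨ ℕ.+-monoˡ-≤ (2 ℕ.* n) (ℕ.≤-trans 2≤n (ℕ.m≤m+n n _)) ⟩
    2 ℕ.* n + 2 ℕ.* n  ≡⟨ double n ⟩
    n ℕ.* 4            ∎
    where
    double : ∀ n → 2 ℕ.* n + 2 ℕ.* n ≡ n ℕ.* 4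
    double = solve-∀

^-bound : ∀ n k → 1 ≤ n → n ≤ k → ∀ s (Q : Fin s → Code n k) → Identifies Q → k ^ n ≤ 2 ^ (16 ℕ.* s)
-- For lengths 1 and 2 the alphabet bound, raised to the length, gives the exponents `2 * s` and
-- `6 * s`.
^-bound 1 (suc k) _ (s≤s n≤k) s Q identifies =
  ^-bound-short (suc k) 1 s (s ℕ.* 1 + s) (alphabet-bound n≤k Q identifies) (subst (_≤ 16 ℕ.* s) (sym (2s s)) (ℕ.*-monoˡ-≤ s (ℕ.m≤m+n 2 14)))
  where
  2s : ∀ s → (s ℕ.* 1 + s) ℕ.* 1 ≡ 2 ℕ.* s
  2s = solve-∀
^-bound 2 (suc k) _ (s≤s n≤k) s Q identifies =
  ^-bound-short (suc k) 2 s (s ℕ.* 2 + s) (alphabet-bound n≤k Q identifies) (subst (_≤ 16 ℕ.* s) (sym (6s s)) (ℕ.*-monoˡ-≤ s (ℕ.m≤m+n 6 10)))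
  where
  6s : ∀ s → (s ℕ.* 2 + s) ℕ.* 2 ≡ 6 ℕ.* s
  6s = solve-∀
^-bound (suc n@(suc (suc _))) (suc k) _ (s≤s n≤k) s Q identifies =
  ^-bound-long k n s (s≤s (s≤s z≤n)) n≤k (falling-bound n≤k Q identifies)

-- Logarithms and rational arithmetic.

^-cancelˡ-≤ : ∀ b → 1 ℕ.< b → ∀ {m n} → b ^ m ≤ b ^ n → m ≤ n
^-cancelˡ-≤ b 1<b b^m≤b^n = ℕ.≮⇒≥ (λ n<m → ℕ.≤⇒≯ b^m≤b^n (ℕ.^-monoʳ-< b 1<b n<m))

-- Logarithm-free form of: `a / b` at most log₂ k and n log₂ k at most `e` give `(a / b) * n` at
-- most `e`. Both routes pass through `k ^ (b * n)`.
exponent-bound : ∀ a b k n e → 2 ^ a ≤ k ^ b → k ^ n ≤ 2 ^ e → a ℕ.* n ≤ e ℕ.* b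
exponent-bound a b k n e 2^a≤k^b k^n≤2^e = ^-cancelˡ-≤ 2 (s≤s (s≤s z≤n)) (begin
  2 ^ (a ℕ.* n)      ≡⟨ ℕ.^-*-assoc 2 a n ⟨
  (2 ^ a) ^ n        ≤⟨ ℕ.^-monoˡ-≤ n 2^a≤k^b ⟩
  (k ^ b) ^ n        ≡⟨ ℕ.^-*-assoc k b n ⟩
  k ^ (b ℕ.* n)      ≡⟨ cong (k ^_) (ℕ.*-comm b n) ⟩
  k ^ (n ℕ.* b)      ≡⟨ ℕ.^-*-assoc k n b ⟨
  (k ^ n) ^ b        ≤⟨ ℕ.^-monoˡ-≤ b k^n≤2^e ⟩
  (2 ^ e) ^ b        ≡⟨ ℕ.^-*-assoc 2 e b ⟩
  2 ^ (e ℕ.* b)      ∎)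
  where open ℕ.≤-Reasoning

toℚᵘ-fromℕ : ∀ m → toℚᵘ (fromℕ m) ℚᵘ.≃ mkℚᵘ (ℤ.+ m) 0
toℚᵘ-fromℕ m = ℚ.toℚᵘ-fromℚᵘ (mkℚᵘ (ℤ.+ m) 0)

fromℕ-nonNeg : ∀ m → NonNegative (fromℕ m)
fromℕ-nonNeg m = ℚ.normalize-nonNeg m 1

c₀ : ℚ
c₀ = ℤ.+ 1 / 16

·log₂-bound : ∀ n k s → k ^ n ≤ 2 ^ (16 ℕ.* s) → (c₀ * fromℕ n) ·log₂ k ≤ fromℕ s
-- Negative rationals lie in every cut; for them the product is nonpositive.
·log₂-bound n k s k^n≤ r@(mkℚ ℤ.-[1+ _ ] _ _) _ = ℚ.≤-trans
  (ℚ.nonPositive⁻¹ _ {{ℚ.nonNeg*nonPos⇒nonPos (c₀ * fromℕ n) {{c₀n≥0}} r}})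
  (ℚ.nonNegative⁻¹ _ {{fromℕ-nonNeg s}})
  where
  c₀n≥0 = ℚ.nonNeg*nonNeg⇒nonNeg c₀ (fromℕ n) {{fromℕ-nonNeg n}}
·log₂-bound n k s k^n≤ r@(mkℚ (ℤ.+ a) b-1 _) 2^a≤k^b = ℚ.toℚᵘ-cancel-≤ (begin
  toℚᵘ (c₀ * fromℕ n * r)                                  ≃⟨ ℚ.toℚᵘ-homo-* (c₀ * fromℕ n) r ⟩
  toℚᵘ (c₀ * fromℕ n) ℚᵘ.* toℚᵘ r                          ≃⟨ ℚᵘ.*-congʳ (ℚ.toℚᵘ-homo-* c₀ (fromℕ n)) ⟩
  toℚᵘ c₀ ℚᵘ.* toℚᵘ (fromℕ n) ℚᵘ.* toℚᵘ r                  ≃⟨ ℚᵘ.*-congʳ (ℚᵘ.*-congˡ {toℚᵘ c₀} (toℚᵘ-fromℕ n)) ⟩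
  -- Without reduction to lowest terms, cross-multiplication leaves `n * a ≤ s * (16 * b)`, where
  -- `b` is `suc b-1`; the 15 is the denominator 16 minus one.
  mkℚᵘ (ℤ.+ 1) 15 ℚᵘ.* mkℚᵘ (ℤ.+ n) 0 ℚᵘ.* mkℚᵘ (ℤ.+ a) b-1  ≤⟨ *≤* (subst₂ ℤ._≤_ (sym lhs) (ℤ.pos-* s _) (ℤ.+≤+ na≤)) ⟩
  mkℚᵘ (ℤ.+ s) 0                                           ≃⟨ toℚᵘ-fromℕ s ⟨
  toℚᵘ (fromℕ s)                                           ∎)
  where
  open ℚᵘ.≤-Reasoning
  lhs : ℤ.+ 1 ℤ.* ℤ.+ n ℤ.* ℤ.+ a ℤ.* ℤ.+ 1 ≡ ℤ.+ (n ℕ.* a)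
  lhs = trans (ℤ.*-identityʳ _) (trans (cong (ℤ._* ℤ.+ a) (ℤ.*-identityˡ (ℤ.+ n))) (sym (ℤ.pos-* n a)))
  regroup : ∀ s b → 16 ℕ.* s ℕ.* b ≡ s ℕ.* (16 ℕ.* b)
  regroup = solve-∀
  na≤ : n ℕ.* a ≤ s ℕ.* (16 ℕ.* suc b-1)
  na≤ = subst₂ _≤_ (ℕ.*-comm a n) (regroup s (suc b-1)) (exponent-bound a (suc b-1) k n (16 ℕ.* s) 2^a≤k^b k^n≤)

theorem4 : ∃[ c ] (0ℚ < c × (∀ (n k : ℕ) → 1 ≤ n → n ≤ k → ∀ (s : ℕ) (Q : Fin s → Code n k) → Identifies Q → (c * fromℕ n) ·log₂ k ≤ fromℕ s))
theorem4 = c₀ , ℚ.positive⁻¹ c₀ , λ n k 1≤n n≤k s Q identifies →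
  ·log₂-bound n k s (^-bound n k 1≤n n≤k s Q identifies)
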